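{- The following three decision problems are undecidable: - $\mathbf{MD}$: determine whether a given elementary class of frames (given by a first-order sentence $C$ defining it) is modally definable with respect to the class of all frames; - $\mathbf{PD}$: determine whether a given elementary class of frames (given by a first-order sentence $C$ defining it) is positively definable with respect to the class of all frames; - $\mathbf{ND}$: determine whether a given elementary class of frames (given by a first-order sentence $C$ defining it) is negatively definable with respect to the class of all frames.
   Context: Syntax. $\mathbf{At}=\{p_i : i\in\mathbb{N}\}$ is a countable set of atoms (enumerated without repetition). The set $\mathbf{Fo}$ of formulas is generated by $A ::= p \mid (A\rightharpoonup A)\mid (A\leftharpoondown A)\mid \top\mid\bot\mid (A\vee A)\mid (A\wedge A)\mid \lozenge A\mid\square A\mid⧫ A\mid\blacksquare A$, with $p\in\mathbf{At}$. A signed formula is a pair $(\alpha,A)$ with $\alpha\in\{+,-\}$ and $A\in\mathbf{Fo}$. Semantics. A frame is a triple $(W,\leq,R)$ where $W\neq\emptyset$, $\leq$ is a preorder on $W$ and $R$ is a binary relation on $W$; $\geq$ is the converse of $\leq$. A valuation is a function $V:\mathbf{At}\to\wp(W)$ such that each $V(p)$ is $\leq$-closed (if $s\in V(p)$ and $s\leq t$ then $t\in V(p)$). A model based on $(W,\leq,R)$ is $(W,\leq,R,V)$ with $V$ a valuation. Satisfaction at $s\in W$: $s\models p$ iff $s\in V(p)$; $s\models\top$; $s\not\models\bot$; $\vee,\wedge$ as usual pointwise; - $s\models A\rightharpoonup B$ iff for all $t\geq s$, $t\not\models A$ or $t\models B$; - $s\models A\leftharpoondown B$ iff there is $t\leq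 s$ with $t\not\models A$ and $t\models B$; - $s\models\lozenge A$ iff there are $t\leq s$ and $u$ with $tRu$ and $u\models A$; - $s\models\square A$ iff for all $t\geq s$ and all $u$, $tRu$ implies $u\models A$; - $s\models⧫ A$ iff for all $t\geq s$ there is $u$ with $tRu$ and $u\models A$; - $s\models\blacksquare A$ iff there is $t\leq s$ such that for all $u$, $tRu$ implies $u\models A$. Further, $s\models(+,A)$ iff $s\models A$, and $s\models(-,A)$ iff $s\not\models A$. A signed formula is valid in a frame if it is satisfied at every point of every model based on the frame. First-order language. First-order formulas are built from atomic formulas $R(x,y)$, $x=y$, $x\leq y$ (over a countable set of individual variables) with $\bot,\neg,\vee,\forall$, and are interpreted classically in frames $(W,\leq,R)$ in the obvious way; a sentence is a first-order formula without free variables. A class $\mathcal{C}$ of frames is elementary if there is a sentence $C$ such that for every frame, the frame satisfies $C$ iff it is in $\mathcal{C}$. Definability. An inference rule consists of $m\in\mathbb{N}$ signed formulas $(\alpha_1,A_1),\dots,(\alpha_m,A_m)$ (premises) and a signed formula $(\beta,B)$ (conclusion). A frame respects the rule if: whenever all premises are valid in the frame, the conclusion is valid in the frame. A class $\mathcal{C}$ of frames corresponds to an inference rule with respect to a class $\mathcal{D}$ if for every frame in $\mathcal{D}$, the frame respects the rule iff it is in $\mathcal{C}$. The class $\mathcal{C}$ is modally definable with respect to $\mathcal{D}$ if it corresponds to some inference rule with respect to $\mathcal{D}$; positively definable with respect to $\mathcal{D}$ if it corresponds to some inference rule without premises with respect to $\mathcal{D}$; negatively definable with respect to $\mathcal{D}$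 if it corresponds with respect to $\mathcal{D}$ to some inference rule with conclusion $(-,\top)$ or to some inference rule with conclusion $(+,\bot)$. -}

module Defs where

open import Data.Bool.Base using (if_then_else_)
open import Data.Empty using (⊥)
open import Data.Fin.Base using (Fin)
open import Data.List.Base using (List; [])
open import Data.List.Relation.Unary.All using (All)
open import Data.Nat.Base using (ℕ; zero; suc; _+_; _*_; _^_; _<_)
open import Data.Nat.Properties using (_≟_)
open import Data.Product.Base using (Σ; ∃; ∃-syntax; _×_; _,_; proj₁)
open import Data.Sign.Base as Sign using (Sign)
open import Data.Sum.Base using (_⊎_)
open import Data.Unit.Base using (⊤)
open import Data.Vec.Base as Vec using (Vec; _∷_; lookup)
open import Data.Vec.Relation.Binary.Pointwise.Inductive using (Pointwise)
open import Function.Bundles using (_⇔_)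
open import Level using (Level; 0ℓ) renaming (suc to lsuc; _⊔_ to _⊔ˡ_)
open import Relation.Binary.Core using (Rel)
open import Relation.Binary.PropositionalEquality.Core using (_≡_)
open import Relation.Binary.Structures using (IsPreorder)
open import Relation.Nullary.Decidable.Core using (does)
open import Relation.Nullary.Negation.Core using (¬_)
open import Relation.Unary using (Pred; U)

------------------------------------------------------------------------
-- Modal formulas

infixr 5 _⇀_ _↽_
infixr 6 _∨_
infixr 7 _∧_
infixr 8 ◇_ □_ ⧫_ ■_

data Fo : Set where
  atom        : ℕ → Fo
  _⇀_ _↽_     : Fo → Fo → Fo
  top bot     : Fo
  _∨_ _∧_     : Fo → Fo → Fo
  ◇_ □_ ⧫_ ■_ : Fo → Fo

SignedFo : Set
SignedFo = Sign × Fo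

------------------------------------------------------------------------
-- Frames, models, satisfaction, validity

record Frame : Set₁ where
  infix 4 _≤_
  field
    W          : Set
    point      : W   -- W is non-empty; nothing below depends on the choice
    _≤_        : Rel W 0ℓ
    isPreorder : IsPreorder _≡_ _≤_
    R          : Rel W 0ℓ

record Valuation (F : Frame) : Set₁ where
  open Frame F
  field
    V      : ℕ → Pred W 0ℓ
    closed : ∀ p {s t} → V p s → s ≤ t → V p t

module _ {F : Frame} (𝒱 : Valuation F) where
  open Frame F
  open Valuation 𝒱

  infix 4 _⊨_ _⊨±_

  _⊨_ : W → Fo → Set
  s ⊨ atom p  = V p s
  s ⊨ (A ⇀ B) = ∀ t → s ≤ t → ¬ (t ⊨ A) ⊎ t ⊨ B
  s ⊨ (A ↽ B) = ∃[ t ] t ≤ s × ¬ (t ⊨ A) × t ⊨ B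
  s ⊨ top     = ⊤
  s ⊨ bot     = ⊥
  s ⊨ (A ∨ B) = s ⊨ A ⊎ s ⊨ B
  s ⊨ (A ∧ B) = s ⊨ A × s ⊨ B
  s ⊨ (◇ A)   = ∃[ t ] ∃[ u ] t ≤ s × R t u × u ⊨ A
  s ⊨ (□ A)   = ∀ t → s ≤ t → ∀ u → R t u → u ⊨ A
  s ⊨ (⧫ A)   = ∀ t → s ≤ t → ∃[ u ] R t u × u ⊨ A
  s ⊨ (■ A)   = ∃[ t ] t ≤ s × (∀ u → R t u → u ⊨ A)

  _⊨±_ : W → SignedFo → Set
  s ⊨± (Sign.+ , A) = s ⊨ A
  s ⊨± (Sign.- , A) = ¬ (s ⊨ A)

Valid : Frame → SignedFo → Set₁
Valid F σ = (𝒱 : Valuation F) (s : Frame.W F) → _⊨±_ 𝒱 s σ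

------------------------------------------------------------------------
-- Inference rules and definability

record Rule : Set where
  constructor _/_
  field
    premises   : List SignedFo
    conclusion : SignedFo

open Rule public

Respects : Frame → Rule → Set₁
Respects F r = All (Valid F) (premises r) → Valid F (conclusion r)

CorrespondsTo : ∀ {c d} → Pred Frame c → Rule → Pred Frame d → Set (lsuc 0ℓ ⊔ˡ c ⊔ˡ d)
CorrespondsTo 𝒞 r 𝒟 = ∀ F → 𝒟 F → Respects F r ⇔ 𝒞 F

module _ {c d : Level} (𝒞 : Pred Frame c) (𝒟 : Pred Frame d) where

  ModallyDefinable : Set (lsuc 0ℓ ⊔ˡ c ⊔ˡ d)
  ModallyDefinable = ∃[ r ] CorrespondsTo 𝒞 r 𝒟

  PositivelyDefinable : Set (lsuc 0ℓ ⊔ˡ c ⊔ˡ d)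
  PositivelyDefinable = ∃[ r ] premises r ≡ [] × CorrespondsTo 𝒞 r 𝒟

  NegativelyDefinable : Set (lsuc 0ℓ ⊔ˡ c ⊔ˡ d)
  NegativelyDefinable =
      (∃[ r ] conclusion r ≡ (Sign.- , top) × CorrespondsTo 𝒞 r 𝒟)
    ⊎ (∃[ r ] conclusion r ≡ (Sign.+ , bot) × CorrespondsTo 𝒞 r 𝒟)

------------------------------------------------------------------------
-- First-order language of frames; the individual variables are the
-- natural numbers

data FOFormula : Set where
  Rᶠ _≈ᶠ_ _≤ᶠ_ : (x y : ℕ) → FOFormula
  ⊥ᶠ           : FOFormula
  ¬ᶠ_          : FOFormula → FOFormula
  _∨ᶠ_         : FOFormula → FOFormula → FOFormula
  ∀ᶠ           : (x : ℕ) → FOFormula → FOFormula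

FreeIn : ℕ → FOFormula → Set
FreeIn z (Rᶠ x y)  = z ≡ x ⊎ z ≡ y
FreeIn z (x ≈ᶠ y)  = z ≡ x ⊎ z ≡ y
FreeIn z (x ≤ᶠ y)  = z ≡ x ⊎ z ≡ y
FreeIn z ⊥ᶠ        = ⊥
FreeIn z (¬ᶠ A)    = FreeIn z A
FreeIn z (A ∨ᶠ B)  = FreeIn z A ⊎ FreeIn z B
FreeIn z (∀ᶠ x A)  = ¬ (z ≡ x) × FreeIn z A

Sentence : Set
Sentence = Σ FOFormula λ A → ∀ z → ¬ FreeIn z A

_[_↦_] : {W : Set} → (ℕ → W) → ℕ → W → (ℕ → W)
(ρ [ x ↦ w ]) y = if does (x ≟ y) then w else ρ y

module _ (F : Frame) where
  open Frame F

  Sat : (ℕ → W) → FOFormula → Set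
  Sat ρ (Rᶠ x y)  = R (ρ x) (ρ y)
  Sat ρ (x ≈ᶠ y)  = ρ x ≡ ρ y
  Sat ρ (x ≤ᶠ y)  = ρ x ≤ ρ y
  Sat ρ ⊥ᶠ        = ⊥
  Sat ρ (¬ᶠ A)    = ¬ Sat ρ A
  Sat ρ (A ∨ᶠ B)  = Sat ρ A ⊎ Sat ρ B
  Sat ρ (∀ᶠ x A)  = ∀ w → Sat (ρ [ x ↦ w ]) A

-- The elementary class of frames defined by a sentence.
Mod : Sentence → Pred Frame 0ℓ
Mod (C , _) F = ∀ ρ → Sat F ρ C

------------------------------------------------------------------------
-- Partial recursive functions

data PartRec : ℕ → Set where
  zeroᵖ : ∀ {n} → PartRec n
  sucᵖ  : PartRec 1
  proj  : ∀ {n} → Fin n → PartRec n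
  comp  : ∀ {m n} → PartRec m → Vec (PartRec n) m → PartRec n
  rec   : ∀ {n} → PartRec n → PartRec (2 + n) → PartRec (1 + n)
  min   : ∀ {n} → PartRec (1 + n) → PartRec n

infix 4 _[_]⇓_

-- f [ xs ]⇓ y: f is defined at xs with value y.
data _[_]⇓_ : ∀ {n} → PartRec n → Vec ℕ n → ℕ → Set where
  ⇓zero : ∀ {n} {xs : Vec ℕ n} → zeroᵖ [ xs ]⇓ 0
  ⇓suc  : ∀ {x} → sucᵖ [ x ∷ Vec.[] ]⇓ suc x
  ⇓proj : ∀ {n} {i : Fin n} {xs} → proj i [ xs ]⇓ lookup xs i
  ⇓comp : ∀ {m n} {f : PartRec m} {gs : Vec (PartRec n) m} {xs ys z} →
          Pointwise (λ g y → g [ xs ]⇓ y) gs ys → f [ ys ]⇓ z →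
          comp f gs [ xs ]⇓ z
  ⇓rec₀ : ∀ {n} {f : PartRec n} {g xs y} →
          f [ xs ]⇓ y →
          rec f g [ 0 ∷ xs ]⇓ y
  ⇓rec₊ : ∀ {n} {f : PartRec n} {g k xs y z} →
          rec f g [ k ∷ xs ]⇓ y → g [ k ∷ y ∷ xs ]⇓ z →
          rec f g [ suc k ∷ xs ]⇓ z
  ⇓min  : ∀ {n} {f : PartRec (1 + n)} {xs y} →
          (∀ i → i < y → ∃[ k ] f [ i ∷ xs ]⇓ suc k) → f [ y ∷ xs ]⇓ 0 →
          min f [ xs ]⇓ y

------------------------------------------------------------------------
-- Gödel numbering and decision problems about sentences

-- A computable injection ℕ × ℕ → ℕ.
⟨_,_⟩ : ℕ → ℕ → ℕ
⟨ x , y ⟩ = 2 ^ x * (1 + 2 * y)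

⌜_⌝ : FOFormula → ℕ
⌜ Rᶠ x y ⌝  = ⟨ 0 , ⟨ x , y ⟩ ⟩
⌜ x ≈ᶠ y ⌝  = ⟨ 1 , ⟨ x , y ⟩ ⟩
⌜ x ≤ᶠ y ⌝  = ⟨ 2 , ⟨ x , y ⟩ ⟩
⌜ ⊥ᶠ ⌝      = ⟨ 3 , 0 ⟩
⌜ ¬ᶠ A ⌝    = ⟨ 4 , ⌜ A ⌝ ⟩
⌜ A ∨ᶠ B ⌝  = ⟨ 5 , ⟨ ⌜ A ⌝ , ⌜ B ⌝ ⟩ ⟩
⌜ ∀ᶠ x A ⌝  = ⟨ 6 , ⟨ x , ⌜ A ⌝ ⟩ ⟩

-- Nothing is required of f on numbers that do not code a sentence; this
-- does not affect decidability, as the set of codes of sentences is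
-- recursive.
Decides : ∀ {ℓ} → PartRec 1 → Pred Sentence ℓ → Set ℓ
Decides f P = ∀ C → (P C → f [ ⌜ proj₁ C ⌝ ∷ Vec.[] ]⇓ 1)
                  × (¬ P C → f [ ⌜ proj₁ C ⌝ ∷ Vec.[] ]⇓ 0)

Undecidable : ∀ {ℓ} → Pred Sentence ℓ → Set ℓ
Undecidable P = ¬ (∃[ f ] Decides f P)

-- U is the class of all frames.
MD PD ND : Pred Sentence (lsuc 0ℓ)
MD C = ModallyDefinable (Mod C) U
PD C = PositivelyDefinable (Mod C) U
ND C = NegativelyDefinable (Mod C) U

{-# OPTIONS --safe #-}
module Submission where

-- Adding a disjoint copy of a frame changes no validity, so a modally definable
-- class is closed under doubling.  Given a partial recursive f, diagonalisation
-- yields a sentence C, with code c, saying that zero is the only R-reflexive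
-- point and that the computation of f at c has a nonzero value.  If f rejects c,
-- C has no models, hence is definable in each of the three ways; if f accepts c,
-- C holds in a standard model but not in its double.
--
-- No theory of arithmetic is needed: the graph of f is expressed so that a true
-- value is the only possible one in every frame, whereas its existence is only
-- required in the standard model.

open import Axiom.ExcludedMiddle using (ExcludedMiddle)
open import Data.Bool.Base using (Bool; true; false)
open import Data.Empty using (⊥; ⊥-elim)
open import Data.Fin.Base using (Fin; zero; suc; _↑ˡ_; _↑ʳ_)
open import Data.Fin.Patterns using (0F; 1F; 2F; 3F; 4F)
open import Data.List.Base using ([])
open import Data.List.Relation.Unary.All as All using ([])
open import Data.Nat.Base as ℕ using (ℕ; zero; suc; _+_; _*_; _^_; _<_; z≤n; s≤s)
open import Data.Nat.Properties
  using (_≟_; ≤-refl; ≤-trans; m≤n⇒m<n∨m≡n; m≤n⇒m≤1+n; <⇒≢; +-suc; +-identityʳ; n≤1+n; m≤n+m)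
open import Data.Product.Base using (∃-syntax; _×_; _,_; proj₁; proj₂)
open import Data.Sign.Base as Sign using ()
open import Data.Sum.Base using (_⊎_; inj₁; inj₂; [_,_]′)
open import Data.Vec.Base using (Vec; []; _∷_; _++_; lookup; map)
open import Data.Vec.Functional using () renaming (_∷_ to _◂_)
open import Data.Vec.Properties using (lookup-++ˡ; lookup-++ʳ; lookup-map)
open import Data.Vec.Relation.Binary.Pointwise.Inductive using (Pointwise; []; _∷_)
open import Function.Base using (_∘_; id)
open import Function.Bundles using (_⇔_; mk⇔; Equivalence)
open import Level using (0ℓ)
open import Relation.Binary.PropositionalEquality
  using (_≡_; _≢_; refl; sym; trans; cong; subst; subst₂; isEquivalence)
open import Relation.Binary.Structures using (IsPreorder)
open import Relation.Nullary.Decidable using (Dec; yes; no; dec-true; dec-false; decidable-stable)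
open import Relation.Nullary.Negation.Core using (¬_; contradiction)
open import Relation.Unary using (Pred; U)
open import Defs

open Equivalence using (to; from)

private
  variable
    k m n : ℕ

-- Disjoint doubling of frames and invariance of validity

double : Frame → Frame
double F = record
  { W = W × Bool
  ; point = point , false
  ; _≤_ = λ (s , b) (t , c) → s ≤ t × b ≡ c
  ; isPreorder = record
      { isEquivalence = isEquivalence
      ; reflexive = λ { refl → P.refl , refl }
      ; trans = λ { (p , refl) (q , refl) → P.trans p q , refl }
      }
  ; R = λ (s , b) (t , c) → R s t × b ≡ c
  }
  where
  open Frame F
  module P = IsPreorder isPreorder

module _ {F : Frame} where
  open Frame F

  restrict : Bool → Valuation (double F) → Valuation F
  restrict b 𝒱 = record
    { V = λ p s → V p (s , b) ; closed = λ p v s≤t → closed p v (s≤t , refl) }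
    where open Valuation 𝒱

  extend : Valuation F → Valuation (double F)
  extend 𝒱 = record
    { V = λ p s → V p (proj₁ s) ; closed = λ p v s≤t → closed p v (proj₁ s≤t) }
    where open Valuation 𝒱

  module _ (𝒱 : Valuation (double F)) (b : Bool) where

    -- Neither `_≤_` nor `R` connects the two copies in either direction, so the clauses that look
    -- down along `_≤_` stay in copy `b` just as those that look up.
    ⊨-restrict : ∀ A {s} → _⊨_ 𝒱 (s , b) A ⇔ _⊨_ (restrict b 𝒱) s A
    ⊨-restrict (atom p) = mk⇔ id id
    ⊨-restrict (A ⇀ B) = mk⇔
      (λ h t s≤t → [ inj₁ ∘ (_∘ from (⊨-restrict A)) , inj₂ ∘ to (⊨-restrict B) ]′
        (h (t , b) (s≤t , refl)))
      (λ { h (t , _) (s≤t , refl) →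
        [ inj₁ ∘ (_∘ to (⊨-restrict A)) , inj₂ ∘ from (⊨-restrict B) ]′ (h t s≤t) })
    ⊨-restrict (A ↽ B) = mk⇔
      (λ { ((t , _) , (t≤s , refl) , ¬a , b) →
        t , t≤s , ¬a ∘ from (⊨-restrict A) , to (⊨-restrict B) b })
      (λ (t , t≤s , ¬a , b) →
        (t , _) , (t≤s , refl) , ¬a ∘ to (⊨-restrict A) , from (⊨-restrict B) b)
    ⊨-restrict top = mk⇔ id id
    ⊨-restrict bot = mk⇔ id id
    ⊨-restrict (A ∨ B) = mk⇔
      [ inj₁ ∘ to (⊨-restrict A) , inj₂ ∘ to (⊨-restrict B) ]′
      [ inj₁ ∘ from (⊨-restrict A) , inj₂ ∘ from (⊨-restrict B) ]′
    ⊨-restrict (A ∧ B) = mk⇔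
      (λ (a , b) → to (⊨-restrict A) a , to (⊨-restrict B) b)
      (λ (a , b) → from (⊨-restrict A) a , from (⊨-restrict B) b)
    ⊨-restrict (◇ A) = mk⇔
      (λ { ((t , _) , (u , _) , (t≤s , refl) , (tRu , refl) , a) →
        t , u , t≤s , tRu , to (⊨-restrict A) a })
      (λ (t , u , t≤s , tRu , a) →
        (t , _) , (u , _) , (t≤s , refl) , (tRu , refl) , from (⊨-restrict A) a)
    ⊨-restrict (□ A) = mk⇔
      (λ h t s≤t u tRu → to (⊨-restrict A) (h (t , _) (s≤t , refl) (u , _) (tRu , refl)))
      (λ { h (t , _) (s≤t , refl) (u , _) (tRu , refl) →
        from (⊨-restrict A) (h t s≤t u tRu) })
    ⊨-restrict (⧫ A) = mk⇔
      (λ h t s≤t → case₁ (h (t , _) (s≤t , refl)))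
      (λ { h (t , _) (s≤t , refl) → case₂ (h t s≤t) })
      where
      case₁ : ∀ {t} → ∃[ u ] Frame.R (double F) (t , b) u × _⊨_ 𝒱 u A →
              ∃[ u ] R t u × _⊨_ (restrict b 𝒱) u A
      case₁ ((u , _) , (tRu , refl) , a) = u , tRu , to (⊨-restrict A) a
      case₂ : ∀ {t} → ∃[ u ] R t u × _⊨_ (restrict b 𝒱) u A →
              ∃[ u ] Frame.R (double F) (t , b) u × _⊨_ 𝒱 u A
      case₂ (u , tRu , a) = (u , _) , (tRu , refl) , from (⊨-restrict A) a
    ⊨-restrict (■ A) = mk⇔
      (λ { ((t , _) , (t≤s , refl) , h) →
        t , t≤s , λ u tRu → to (⊨-restrict A) (h (u , _) (tRu , refl)) })
      (λ (t , t≤s , h) →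
        (t , _) , (t≤s , refl) , λ { (u , _) (tRu , refl) → from (⊨-restrict A) (h u tRu) })

    ⊨±-restrict : ∀ σ {s} → _⊨±_ 𝒱 (s , b) σ ⇔ _⊨±_ (restrict b 𝒱) s σ
    ⊨±-restrict (Sign.+ , A) = ⊨-restrict A
    ⊨±-restrict (Sign.- , A) =
      mk⇔ (_∘ from (⊨-restrict A)) (_∘ to (⊨-restrict A))

  -- Every valuation of `F` arises by restriction, since `restrict false (extend 𝒱)` is `𝒱` itself.
  -- Rules need both directions: premises pass down to `F`, the conclusion passes back up.
  Valid-double : ∀ σ → Valid (double F) σ ⇔ Valid F σ
  Valid-double σ = mk⇔
    (λ v 𝒱 s → to (⊨±-restrict (extend 𝒱) false σ) (v (extend 𝒱) (s , false)))
    (λ v 𝒱 (s , b) → from (⊨±-restrict 𝒱 b σ) (v (restrict b 𝒱) s))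

  Respects-double : ∀ r → Respects F r → Respects (double F) r
  Respects-double r h ps =
    from (Valid-double (conclusion r)) (h (All.map (λ {σ} → to (Valid-double σ)) ps))

MD⇒closed-under-double : ∀ C → MD C → ∀ F → Mod C F → Mod C (double F)
MD⇒closed-under-double C (r , corr) F FC =
  to (corr (double F) _) (Respects-double {F} r (from (corr F _) FC))

PD⇒MD : ∀ C → PD C → MD C
PD⇒MD C (r , _ , corr) = r , corr

ND⇒MD : ∀ C → ND C → MD C
ND⇒MD C (inj₁ (r , _ , corr)) = r , corr
ND⇒MD C (inj₂ (r , _ , corr)) = r , corr

-- Sentences without models are definable

Unsatisfiable : Sentence → Set₁
Unsatisfiable C = ∀ F → ¬ Mod C F

-- A frame has a point and carries the empty valuation, so no frame respects this rule. With no
-- premises and conclusion `bot`, the same rule serves all three notions of definability.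
[]/⊥-corresponds : ∀ C → Unsatisfiable C → CorrespondsTo (Mod C) ([] / (Sign.+ , bot)) U
[]/⊥-corresponds C unsat F _ = mk⇔
  (λ h → ⊥-elim (h [] (record { V = λ _ _ → ⊥ ; closed = λ _ () }) (Frame.point F)))
  (⊥-elim ∘ unsat F)

Unsatisfiable⇒MD : ∀ C → Unsatisfiable C → MD C
Unsatisfiable⇒MD C unsat = [] / (Sign.+ , bot) , []/⊥-corresponds C unsat

Unsatisfiable⇒PD : ∀ C → Unsatisfiable C → PD C
Unsatisfiable⇒PD C unsat = [] / (Sign.+ , bot) , refl , []/⊥-corresponds C unsat

Unsatisfiable⇒ND : ∀ C → Unsatisfiable C → ND C
Unsatisfiable⇒ND C unsat = inj₂ ([] / (Sign.+ , bot) , refl , []/⊥-corresponds C unsat)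

-- Well-scoped first-order formulas

data Fm : ℕ → Set where
  rel eq leq : (x y : Fin m) → Fm m
  not        : Fm m → Fm m
  and or imp : Fm m → Fm m → Fm m
  all ex     : Fm (suc m) → Fm m

module _ (F : Frame) where
  open Frame F

  ⟦_⟧ : Fm m → Vec W m → Set
  ⟦ rel x y ⟧ σ = R (lookup σ x) (lookup σ y)
  ⟦ eq x y ⟧ σ  = lookup σ x ≡ lookup σ y
  ⟦ leq x y ⟧ σ = lookup σ x ≤ lookup σ y
  ⟦ not φ ⟧ σ   = ¬ ⟦ φ ⟧ σ
  ⟦ and φ ψ ⟧ σ = ⟦ φ ⟧ σ × ⟦ ψ ⟧ σ
  ⟦ or φ ψ ⟧ σ  = ⟦ φ ⟧ σ ⊎ ⟦ ψ ⟧ σ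
  ⟦ imp φ ψ ⟧ σ = ⟦ φ ⟧ σ → ⟦ ψ ⟧ σ
  ⟦ all φ ⟧ σ   = ∀ w → ⟦ φ ⟧ (w ∷ σ)
  ⟦ ex φ ⟧ σ    = ∃[ w ] ⟦ φ ⟧ (w ∷ σ)

named : Vec ℕ m → ℕ → Fm m → FOFormula
named ν d (rel x y) = Rᶠ (lookup ν x) (lookup ν y)
named ν d (eq x y)  = lookup ν x ≈ᶠ lookup ν y
named ν d (leq x y) = lookup ν x ≤ᶠ lookup ν y
named ν d (not φ)   = ¬ᶠ named ν d φ
named ν d (and φ ψ) = ¬ᶠ ((¬ᶠ named ν d φ) ∨ᶠ (¬ᶠ named ν d ψ))
named ν d (or φ ψ)  = named ν d φ ∨ᶠ named ν d ψ
named ν d (imp φ ψ) = (¬ᶠ named ν d φ) ∨ᶠ named ν d ψ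
named ν d (all φ)   = ∀ᶠ d (named (d ∷ ν) (suc d) φ)
named ν d (ex φ)    = ¬ᶠ ∀ᶠ d (¬ᶠ named (d ∷ ν) (suc d) φ)

free-named : ∀ (ν : Vec ℕ m) d φ {z} → FreeIn z (named ν d φ) → ∃[ i ] z ≡ lookup ν i
free-named-binder : ∀ (ν : Vec ℕ m) d φ {z} →
  z ≢ d → FreeIn z (named (d ∷ ν) (suc d) φ) → ∃[ i ] z ≡ lookup ν i

free-named ν d (rel x y) = [ (x ,_) , (y ,_) ]′
free-named ν d (eq x y)  = [ (x ,_) , (y ,_) ]′
free-named ν d (leq x y) = [ (x ,_) , (y ,_) ]′
free-named ν d (not φ)   = free-named ν d φ
free-named ν d (and φ ψ) = [ free-named ν d φ , free-named ν d ψ ]′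
free-named ν d (or φ ψ)  = [ free-named ν d φ , free-named ν d ψ ]′
free-named ν d (imp φ ψ) = [ free-named ν d φ , free-named ν d ψ ]′
free-named ν d (all φ) (z≢d , p) = free-named-binder ν d φ z≢d p
free-named ν d (ex φ)  (z≢d , p) = free-named-binder ν d φ z≢d p

free-named-binder ν d φ z≢d p with free-named (d ∷ ν) (suc d) φ p
... | zero , z≡d = contradiction z≡d z≢d
... | suc i , z≡ = i , z≡

module _ {W : Set} (ρ : ℕ → W) where

  update-≡ : ∀ x {w} → (ρ [ x ↦ w ]) x ≡ w
  update-≡ x rewrite dec-true (x ≟ x) refl = refl

  update-≢ : ∀ {x y w} → x ≢ y → (ρ [ x ↦ w ]) y ≡ ρ y
  update-≢ {x} {y} x≢y rewrite dec-false (x ≟ y) x≢y = refl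

module _ (em : ExcludedMiddle 0ℓ) (F : Frame) where
  open Frame F

  record Env (ν : Vec ℕ m) (d : ℕ) (ρ : ℕ → W) (σ : Vec W m) : Set where
    field
      fresh : ∀ i → lookup ν i < d
      agree : ∀ i → ρ (lookup ν i) ≡ lookup σ i
  open Env

  bind : ∀ {ν : Vec ℕ m} {d ρ σ} w → Env ν d ρ σ → Env (d ∷ ν) (suc d) (ρ [ d ↦ w ]) (w ∷ σ)
  bind w e .fresh zero = ≤-refl
  bind w e .fresh (suc i) = m≤n⇒m≤1+n (fresh e i)
  bind {ρ = ρ} w e .agree zero = update-≡ ρ _
  bind {ρ = ρ} w e .agree (suc i) =
    trans (update-≢ ρ (<⇒≢ (fresh e i) ∘ sym)) (agree e i)

  -- `Sat` sees conjunction, implication and existence only through negation, disjunction and the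
  -- universal quantifier; excluded middle recovers their direct reading.
  sat-named : ∀ {ν : Vec ℕ m} {d ρ σ} → Env ν d ρ σ → ∀ φ →
              Sat F ρ (named ν d φ) ⇔ ⟦_⟧ F φ σ
  sat-named e (rel x y) = mk⇔ (subst₂ R (agree e x) (agree e y))
                              (subst₂ R (sym (agree e x)) (sym (agree e y)))
  sat-named e (eq x y)  = mk⇔ (subst₂ _≡_ (agree e x) (agree e y))
                              (subst₂ _≡_ (sym (agree e x)) (sym (agree e y)))
  sat-named e (leq x y) = mk⇔ (subst₂ _≤_ (agree e x) (agree e y))
                              (subst₂ _≤_ (sym (agree e x)) (sym (agree e y)))
  sat-named e (not φ) = mk⇔ (_∘ from (sat-named e φ)) (_∘ to (sat-named e φ))
  sat-named {ν = ν} {d} {ρ} {σ} e (and φ ψ) = mk⇔ fwd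
    (λ (p , q) → [ (λ ¬p → ¬p (from (sat-named e φ) p)) , (λ ¬q → ¬q (from (sat-named e ψ) q)) ]′)
    where
    fwd : Sat F ρ (named ν d (and φ ψ)) → ⟦_⟧ F (and φ ψ) σ
    fwd h with em {Sat F ρ (named ν d φ)} | em {Sat F ρ (named ν d ψ)}
    ... | yes p | yes q = to (sat-named e φ) p , to (sat-named e ψ) q
    ... | yes p | no ¬q = ⊥-elim (h (inj₂ ¬q))
    ... | no ¬p | _     = ⊥-elim (h (inj₁ ¬p))
  sat-named e (or φ ψ) = mk⇔
    [ inj₁ ∘ to (sat-named e φ) , inj₂ ∘ to (sat-named e ψ) ]′
    [ inj₁ ∘ from (sat-named e φ) , inj₂ ∘ from (sat-named e ψ) ]′
  sat-named {ν = ν} {d} {ρ} {σ} e (imp φ ψ) = mk⇔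
    (λ h p → [ (λ ¬p → ⊥-elim (¬p (from (sat-named e φ) p))) , to (sat-named e ψ) ]′ h) bwd
    where
    bwd : ⟦_⟧ F (imp φ ψ) σ → Sat F ρ (named ν d (imp φ ψ))
    bwd h with em {Sat F ρ (named ν d φ)}
    ... | yes p = inj₂ (from (sat-named e ψ) (h (to (sat-named e φ) p)))
    ... | no ¬p = inj₁ ¬p
  sat-named e (all φ) = mk⇔
    (λ h w → to (sat-named (bind w e) φ) (h w)) (λ h w → from (sat-named (bind w e) φ) (h w))
  sat-named {ν = ν} {d} {ρ} {σ} e (ex φ) = mk⇔ fwd
    (λ (w , p) h → h w (from (sat-named (bind w e) φ) p))
    where
    fwd : Sat F ρ (named ν d (ex φ)) → ⟦_⟧ F (ex φ) σ
    fwd h with em {⟦_⟧ F (ex φ) σ}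
    ... | yes p = p
    ... | no ¬p = ⊥-elim (h λ w q → ¬p (w , to (sat-named (bind w e) φ) q))

exs : ∀ k → Fm (k + m) → Fm m
exs zero    φ = φ
exs (suc k) φ = exs k (ex φ)

module _ (F : Frame) where
  open Frame F

  exs-elim : ∀ k (φ : Fm (k + m)) {σ} → ⟦_⟧ F (exs k φ) σ → ∃[ ws ] ⟦_⟧ F φ (ws ++ σ)
  exs-elim zero    φ h = [] , h
  exs-elim (suc k) φ h with exs-elim k (ex φ) h
  ... | ws , w , p = w ∷ ws , p

  exs-intro : ∀ (φ : Fm (k + m)) {σ} ws → ⟦_⟧ F φ (ws ++ σ) → ⟦_⟧ F (exs k φ) σ
  exs-intro φ []       h = h
  exs-intro φ (w ∷ ws) h = exs-intro (ex φ) ws (w , h)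

-- Graphs of partial recursive functions in frames

isZero : Fin m → Fm m
isZero x = rel x x

-- The last conjunct separates zero from successors in every frame. The first one keeps successor
-- edges apart from the edges used by `mem`: in the standard model `index` and `value` edges never
-- go upwards in `_≼_`.
isSuc : Fin m → Fin m → Fm m
isSuc x y = and (leq x y) (and (rel x y) (not (isZero y)))

-- The pairs (i, v) belonging to s are witnessed by the points c above s
-- with c R i and v R c.
mem : Fin m → Fin m → Fin m → Fm m
mem s i v = ex (and (leq (suc s) 0F) (and (rel 0F (suc i)) (rel (suc v) 0F)))

graph    : PartRec n → (Fin n → Fin m) → Fin m → Fm m
graphAll : Vec (PartRec n) k → (Fin n → Fin m) → (Fin k → Fin m) → Fm m → Fm m

graph zeroᵖ ξ z = isZero z
graph sucᵖ ξ z = isSuc (ξ 0F) z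
graph (proj i) ξ z = eq (ξ i) z
graph {m = m} (comp {k} f gs) ξ z =
  exs k (graphAll gs ((k ↑ʳ_) ∘ ξ) (_↑ˡ m) (graph f (_↑ˡ m) (k ↑ʳ z)))
-- A point s may serve as a course of values if all its pairs are justified:
-- nothing is required to belong to s except the pair (ξ 0F, z).
graph (rec f g) ξ z = ex
  (and (all (all (imp (and (isZero 1F) (mem 2F 1F 0F))
                      (graph f (λ i → suc (suc (suc (ξ (suc i))))) 0F))))
  (and (all (all (all (imp (and (isSuc 2F 1F) (mem 3F 1F 0F))
         (ex (and (mem 4F 3F 0F)
                  (graph g (3F ◂ (0F ◂ (λ i → suc (suc (suc (suc (suc (ξ (suc i))))))))) 1F)))))))
       (mem 0F (suc (ξ 0F)) (suc z))))
-- Climbing by successors from zero, staying below z, one cannot bypass the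
-- true value y: every point below z, other than z itself, has a nonzero value.
graph (min f) ξ z = ex
  (and (isZero 0F)
  (and (leq 0F (suc z))
  (and (graph f (suc z ◂ (suc ∘ ξ)) 0F)
       (all (imp (leq 0F (suc (suc z)))
         (or (eq 0F (suc (suc z)))
             (and (ex (and (graph f (1F ◂ (λ i → suc (suc (suc (ξ i))))) 0F) (not (isZero 0F))))
                  (ex (and (isSuc 1F 0F) (leq 0F (suc (suc (suc z)))))))))))))

graphAll [] ξ ζ φ = φ
graphAll (g ∷ gs) ξ ζ φ = and (graph g ξ (ζ zero)) (graphAll gs ξ (ζ ∘ suc) φ)

module _ (F : Frame) where
  open Frame F

  Succ : W → W → Set
  Succ v w = v ≤ w × R v w × ¬ R w w

  -- In an arbitrary frame many points may have the number `n`, and one point may have several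
  -- positive numbers; only 0 is incompatible with every other number.
  Num : ℕ → W → Set
  Num zero    w = R w w
  Num (suc n) w = ∃[ v ] Num n v × Succ v w

  -- Induction on the computation, not on the formula: the given derivation tells which instances of
  -- the universal clauses to use, so spurious points of the frame do no harm.
  graph-sound : ∀ {f : PartRec n} {xs y} → f [ xs ]⇓ y → ∀ (ξ : Fin n → Fin m) z σ →
    (∀ i → Num (lookup xs i) (lookup σ (ξ i))) → ⟦_⟧ F (graph f ξ z) σ → Num y (lookup σ z)
  graphAll-sound : ∀ {gs : Vec (PartRec n) k} {xs ys} → Pointwise (λ g y → g [ xs ]⇓ y) gs ys →
    ∀ (ξ : Fin n → Fin m) ζ φ σ →
    (∀ i → Num (lookup xs i) (lookup σ (ξ i))) → ⟦_⟧ F (graphAll gs ξ ζ φ) σ →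
    (∀ i → Num (lookup ys i) (lookup σ (ζ i))) × ⟦_⟧ F φ σ

  graph-sound ⇓zero ξ z σ num h = h
  graph-sound (⇓suc {x}) ξ z σ num h = _ , num 0F , h
  graph-sound {xs = xs} (⇓proj {i = i}) ξ z σ num h = subst (Num (lookup xs i)) h (num i)
  graph-sound {m = m} {xs = xs} (⇓comp {m = k} {f = f} {ys = ys} {z = y} ds d) ξ z σ num h
    with ws , p ← exs-elim F k _ h
    with nums , q ← graphAll-sound ds ((k ↑ʳ_) ∘ ξ) (_↑ˡ m) (graph f (_↑ˡ m) (k ↑ʳ z)) (ws ++ σ)
      (λ i → subst (Num (lookup xs i)) (sym (lookup-++ʳ ws σ (ξ i))) (num i)) p
    = subst (Num y) (lookup-++ʳ ws σ z) (graph-sound d (_↑ˡ m) (k ↑ʳ z) (ws ++ σ) nums q)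
  graph-sound {m = m} {f = rec f g} {k ∷ xs} d ξ z σ num (s , base , step , r) = go d (num 0F) r
    where
    -- Generalised to every pair of `s` whose index has a number. The clause `step` covers all
    -- predecessors, hence also the one supplied by `Num`, and the descent ends at `base`.
    go : ∀ {j y i w} → rec f g [ j ∷ xs ]⇓ y → Num j i →
         ⟦_⟧ F (mem 2F 1F 0F) (w ∷ i ∷ s ∷ []) → Num y w
    go (⇓rec₀ d) j-num w∈ = graph-sound d _ _ (_ ∷ _ ∷ s ∷ σ) (num ∘ suc) (base _ _ (j-num , w∈))
    go (⇓rec₊ d e) (i , i-num , i-suc) w∈ with v , v∈ , gv ← step _ _ _ (i-suc , w∈) =
      graph-sound e _ _ (v ∷ _ ∷ _ ∷ i ∷ s ∷ σ)
        (λ { 0F → i-num ; 1F → go d i-num v∈ ; (suc (suc i)) → num (suc i) }) gv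
  graph-sound (⇓min {f = f} {xs = xs} {y = y} pos d) ξ z σ num (o , o-zero , o≤z , fz , chain) =
    climb y (+-identityʳ y) o-zero o≤z
    where
    -- The formula gives `f` the value `o` at `z`. If `z` had a number `j` below `y`, then `o` would
    -- be a successor, yet `o` is a zero.
    not-below : ∀ {j} → j < y → ¬ Num j (lookup σ z)
    not-below {j} j<y z-num with _ , e ← pos j j<y
      with _ , _ , _ , _ , ¬zero ← graph-sound e (suc z ◂ (suc ∘ ξ)) 0F (o ∷ σ)
             (λ { zero → z-num ; (suc i) → num i }) fz
      = ¬zero o-zero

    -- `r` is the distance from `j` to `y`; the climb starts at `o`, which also serves as the
    -- numeral 0. Before `y`, `not-below` rules out having reached `z`; at `y`, the true value 0
    -- refutes the nonzero value claimed by `chain`, so `z` has been reached.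
    climb : ∀ r {j x} → r + j ≡ y → Num j x → x ≤ lookup σ z → Num y (lookup σ z)
    climb r {j} {x} r+j≡y j-num x≤z with r | chain x x≤z
    ... | zero  | inj₁ x≡z = subst₂ Num r+j≡y x≡z j-num
    ... | zero  | inj₂ ((v , fx , ¬zero) , _) =
      ⊥-elim (¬zero (graph-sound d _ _ (v ∷ x ∷ o ∷ σ)
        (λ { zero → subst (λ j → Num j x) r+j≡y j-num ; (suc i) → num i }) fx))
    ... | suc r | inj₁ x≡z =
      ⊥-elim (not-below (subst (j <_) r+j≡y (s≤s (m≤n+m j r))) (subst (Num j) x≡z j-num))
    ... | suc r | inj₂ (_ , x′ , x′-suc , x′≤z) =
      climb r (trans (+-suc r j) r+j≡y) (x , j-num , x′-suc) x′≤z

  graphAll-sound [] ξ ζ φ σ num h = (λ ()) , h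
  graphAll-sound (d ∷ ds) ξ ζ φ σ num (h , hs)
    with nums , p ← graphAll-sound ds ξ (ζ ∘ suc) φ σ num hs
    = (λ { zero → graph-sound d ξ (ζ zero) σ num h ; (suc i) → nums i }) , p

-- In the standard model each program and argument list label their own course
-- of values, whose cells are exactly the true pairs.
data Point : Set where
  num    : ℕ → Point
  course : PartRec (suc n) → Vec ℕ n → Point
  cell   : PartRec (suc n) → Vec ℕ n → (i v : ℕ) → Point

infix 4 _≼_ _⟶_

data _≼_ : Point → Point → Set where
  ≼-refl : ∀ {x} → x ≼ x
  ≼-num  : ∀ {i j} → i ℕ.≤ j → num i ≼ num j
  ≼-cell : ∀ {f : PartRec (suc n)} {xs i v} → f [ i ∷ xs ]⇓ v → course f xs ≼ cell f xs i v

data _⟶_ : Point → Point → Set where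
  loop  : num 0 ⟶ num 0
  next  : ∀ {i} → num i ⟶ num (suc i)
  index : ∀ {f : PartRec (suc n)} {xs i v} → cell f xs i v ⟶ num i
  value : ∀ {f : PartRec (suc n)} {xs i v} → num v ⟶ cell f xs i v

≼-trans : ∀ {x y z} → x ≼ y → y ≼ z → x ≼ z
≼-trans ≼-refl     q         = q
≼-trans p          ≼-refl    = p
≼-trans (≼-num p)  (≼-num q) = ≼-num (≤-trans p q)

standard : Frame
standard = record
  { W = Point
  ; point = num 0
  ; _≤_ = _≼_
  ; isPreorder = record
      { isEquivalence = isEquivalence ; reflexive = λ { refl → ≼-refl } ; trans = ≼-trans }
  ; R = _⟶_
  }

suc-Succ : ∀ i → Succ standard (num i) (num (suc i))
suc-Succ i = ≼-num (n≤1+n i) , next , λ ()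

-- Recursion is on the program, not on the derivation: a course contains all true pairs, and their
-- computations need not be parts of the given one.
graph-complete : ∀ (f : PartRec n) {xs y} → f [ xs ]⇓ y → ∀ (ξ : Fin n → Fin m) z σ →
  (∀ i → lookup σ (ξ i) ≡ num (lookup xs i)) → lookup σ z ≡ num y →
  ⟦_⟧ standard (graph f ξ z) σ
graphAll-complete : ∀ (gs : Vec (PartRec n) k) {xs ys} → Pointwise (λ g y → g [ xs ]⇓ y) gs ys →
  ∀ (ξ : Fin n → Fin m) ζ φ σ →
  (∀ i → lookup σ (ξ i) ≡ num (lookup xs i)) → (∀ i → lookup σ (ζ i) ≡ num (lookup ys i)) →
  ⟦_⟧ standard φ σ → ⟦_⟧ standard (graphAll gs ξ ζ φ) σ

graph-complete zeroᵖ ⇓zero ξ z σ args z≡ rewrite z≡ = loop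
graph-complete sucᵖ (⇓suc {x}) ξ z σ args z≡ rewrite z≡ | args 0F = suc-Succ x
graph-complete (proj i) ⇓proj ξ z σ args z≡ = trans (args i) (sym z≡)
graph-complete {m = m} (comp {k} f gs) (⇓comp {ys = ys} ds d) ξ z σ args z≡ =
  exs-intro standard _ ws
    (graphAll-complete gs ds _ _ (graph f (_↑ˡ m) (k ↑ʳ z)) (ws ++ σ)
      (λ i → trans (lookup-++ʳ ws σ (ξ i)) (args i)) ws≡
      (graph-complete f d (_↑ˡ m) (k ↑ʳ z) (ws ++ σ) ws≡ (trans (lookup-++ʳ ws σ z) z≡)))
  where
  ws : Vec Point k
  ws = map num ys
  ws≡ : ∀ i → lookup (ws ++ σ) (i ↑ˡ m) ≡ num (lookup ys i)
  ws≡ i = trans (lookup-++ˡ ws σ i) (lookup-map i num ys)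
graph-complete (rec f g) {k ∷ xs} {y} d ξ z σ args z≡ = s , base , step ,
  cell (rec f g) xs k y , ≼-cell d , subst (_ ⟶_) (sym (args 0F)) index , subst (_⟶ _) (sym z≡) value
  where
  s : Point
  s = course (rec f g) xs
  base : ∀ o v → o ⟶ o × ⟦_⟧ standard (mem 2F 1F 0F) (v ∷ o ∷ s ∷ []) →
         ⟦_⟧ standard (graph f _ 0F) (v ∷ o ∷ s ∷ σ)
  -- Only a `cell` above `s` can witness membership, and its position above `s` carries a
  -- computation, which is then inverted.
  base _ _ (loop , _ , ≼-cell (⇓rec₀ e) , index , value) =
    graph-complete f e _ _ (_ ∷ _ ∷ s ∷ σ) (args ∘ suc) refl
  step : ∀ i i′ v′ →
         Succ standard i i′ × ⟦_⟧ standard (mem 3F 1F 0F) (v′ ∷ i′ ∷ i ∷ s ∷ []) →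
         ∃[ v ] ⟦_⟧ standard (mem 4F 3F 0F) (v ∷ v′ ∷ i′ ∷ i ∷ s ∷ []) ×
                ⟦_⟧ standard (graph g _ 1F) (v ∷ v′ ∷ i′ ∷ i ∷ s ∷ σ)
  step _ _ _ ((_ , loop , ¬zero) , _) = contradiction loop ¬zero
  step _ _ _ ((_ , next , _) , _ , ≼-cell (⇓rec₊ {y = v} e e′) , index , value) =
    num v , (_ , ≼-cell e , index , value) ,
    graph-complete g e′ _ _ (num v ∷ _ ∷ _ ∷ _ ∷ s ∷ σ)
      (λ { 0F → refl ; 1F → refl ; (suc (suc i)) → args (suc i) }) refl
graph-complete (min f) {xs} {y} (⇓min pos d) ξ z σ args z≡ =
  num 0 , loop , subst (_ ≼_) (sym z≡) (≼-num z≤n) ,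
  graph-complete f d _ _ (num 0 ∷ σ) (λ { zero → z≡ ; (suc i) → args i }) refl ,
  λ x x≼z → chain x (subst (x ≼_) z≡ x≼z)
  where
  chain : ∀ x → x ≼ num y → _
  chain _ ≼-refl = inj₁ (sym z≡)
  chain (num j) (≼-num j≤y) with m≤n⇒m<n∨m≡n j≤y
  ... | inj₂ refl = inj₁ (sym z≡)
  ... | inj₁ j<y with k , e ← pos j j<y = inj₂
    ( (num (suc k) ,
       graph-complete f e _ _ (_ ∷ num j ∷ num 0 ∷ σ) (λ { zero → refl ; (suc i) → args i }) refl ,
       λ ())
    , num (suc j) , suc-Succ j , subst (_ ≼_) (sym z≡) (≼-num j<y))

graphAll-complete [] [] ξ ζ φ σ args vals p = p
graphAll-complete (g ∷ gs) (d ∷ ds) ξ ζ φ σ args vals p =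
  graph-complete g d ξ (ζ zero) σ args (vals zero) ,
  graphAll-complete gs ds ξ (ζ ∘ suc) φ σ args (vals ∘ suc) p

-- Computing codes of formulas

const : ℕ → PartRec n
const zero    = zeroᵖ
const (suc k) = comp sucᵖ (const k ∷ [])

const⇓ : ∀ k {xs : Vec ℕ n} → const k [ xs ]⇓ k
const⇓ zero    = ⇓zero
const⇓ (suc k) = ⇓comp (const⇓ k ∷ []) ⇓suc

addᵖ mulᵖ : PartRec 2
addᵖ = rec (proj 0F) (comp sucᵖ (proj 1F ∷ []))
mulᵖ = rec zeroᵖ (comp addᵖ (proj 2F ∷ proj 1F ∷ []))

add⇓ : ∀ x y → addᵖ [ x ∷ y ∷ [] ]⇓ x + y
add⇓ zero    y = ⇓rec₀ ⇓proj
add⇓ (suc x) y = ⇓rec₊ (add⇓ x y) (⇓comp (⇓proj ∷ []) ⇓suc)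

mul⇓ : ∀ x y → mulᵖ [ x ∷ y ∷ [] ]⇓ x * y
mul⇓ zero    y = ⇓rec₀ ⇓zero
mul⇓ (suc x) y = ⇓rec₊ (mul⇓ x y) (⇓comp (⇓proj ∷ ⇓proj ∷ []) (add⇓ y (x * y)))

2^ᵖ : PartRec 1
2^ᵖ = rec (const 1) (comp mulᵖ (const 2 ∷ proj 1F ∷ []))

2^⇓ : ∀ x → 2^ᵖ [ x ∷ [] ]⇓ 2 ^ x
2^⇓ zero    = ⇓rec₀ (const⇓ 1)
2^⇓ (suc x) = ⇓rec₊ (2^⇓ x) (⇓comp (const⇓ 2 ∷ ⇓proj ∷ []) (mul⇓ 2 (2 ^ x)))

pairᵖ : PartRec n → PartRec n → PartRec n
pairᵖ f g = comp mulᵖ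
  (comp 2^ᵖ (f ∷ []) ∷ comp sucᵖ (comp mulᵖ (const 2 ∷ g ∷ []) ∷ []) ∷ [])

pair⇓ : ∀ {f g : PartRec n} {xs x y} → f [ xs ]⇓ x → g [ xs ]⇓ y → pairᵖ f g [ xs ]⇓ ⟨ x , y ⟩
pair⇓ {x = x} {y} d e = ⇓comp
  (⇓comp (d ∷ []) (2^⇓ x) ∷ ⇓comp (⇓comp (const⇓ 2 ∷ e ∷ []) (mul⇓ 2 y) ∷ []) ⇓suc ∷ [])
  (mul⇓ (2 ^ x) (1 + 2 * y))

¬ᵖ_ : PartRec n → PartRec n
¬ᵖ f = pairᵖ (const 4) f

_∨ᵖ_ : PartRec n → PartRec n → PartRec n
f ∨ᵖ g = pairᵖ (const 5) (pairᵖ f g)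

∀ᵖ : ℕ → PartRec n → PartRec n
∀ᵖ x f = pairᵖ (const 6) (pairᵖ (const x) f)

-- Codes of concrete formulas are astronomical and must not be evaluated
-- during type checking.
opaque
  code : FOFormula → ℕ
  code = ⌜_⌝

  code≡ : ∀ A → code A ≡ ⌜ A ⌝
  code≡ A = refl

  ¬⇓ : ∀ {f : PartRec n} {xs A} → f [ xs ]⇓ code A → (¬ᵖ f) [ xs ]⇓ code (¬ᶠ A)
  ¬⇓ {A = A} d = pair⇓ {y = ⌜ A ⌝} (const⇓ 4) d

  ∨⇓ : ∀ {f g : PartRec n} {xs A B} → f [ xs ]⇓ code A → g [ xs ]⇓ code B →
       (f ∨ᵖ g) [ xs ]⇓ code (A ∨ᶠ B)
  ∨⇓ {A = A} {B} d e = pair⇓ {y = ⟨ ⌜ A ⌝ , ⌜ B ⌝ ⟩} (const⇓ 5) (pair⇓ {x = ⌜ A ⌝} {⌜ B ⌝} d e)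

  ∀⇓ : ∀ {f : PartRec n} {xs A} x → f [ xs ]⇓ code A → (∀ᵖ x f) [ xs ]⇓ code (∀ᶠ x A)
  ∀⇓ {A = A} x d = pair⇓ {y = ⟨ x , ⌜ A ⌝ ⟩} (const⇓ 6) (pair⇓ {y = ⌜ A ⌝} (const⇓ x) d)

-- Diagonalisation

notSucc : FOFormula
notSucc = (¬ᶠ (0 ≤ᶠ 1)) ∨ᶠ ((¬ᶠ Rᶠ 0 1) ∨ᶠ Rᶠ 1 1)

uniqueZero : FOFormula
uniqueZero = ∀ᶠ 0 (∀ᶠ 1 ((¬ᶠ Rᶠ 0 0) ∨ᶠ ((¬ᶠ Rᶠ 1 1) ∨ᶠ (0 ≈ᶠ 1))))

-- Variable 1 ranges over the successors of variable 0, which is then rebound to it. Two variables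
-- thus suffice for any number of layers, and all layers have the same shape, so codes are obtained
-- by plain iteration.
allSucc : FOFormula → FOFormula
allSucc A = ∀ᶠ 1 (notSucc ∨ᶠ ∀ᶠ 0 ((¬ᶠ (0 ≈ᶠ 1)) ∨ᶠ A))

allSuccs : ℕ → FOFormula → FOFormula
allSuccs zero    A = A
allSuccs (suc n) A = allSucc (allSuccs n A)

-- The numeral is plugged in by quantifying along successor chains, which avoids syntactic
-- substitution. `uniqueZero` is the conjunct that a double refutes.
failsAtNumeral : ℕ → FOFormula → FOFormula
failsAtNumeral n A = ¬ᶠ ((¬ᶠ uniqueZero) ∨ᶠ ∀ᶠ 0 ((¬ᶠ Rᶠ 0 0) ∨ᶠ allSuccs n A))

allSuccᵖ : PartRec n → PartRec n
allSuccᵖ f = ∀ᵖ 1 (const (code notSucc) ∨ᵖ ∀ᵖ 0 (const (code (¬ᶠ (0 ≈ᶠ 1))) ∨ᵖ f))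

allSucc⇓ : ∀ {f : PartRec n} {xs A} → f [ xs ]⇓ code A → allSuccᵖ f [ xs ]⇓ code (allSucc A)
allSucc⇓ d = ∀⇓ 1 (∨⇓ (const⇓ _) (∀⇓ 0 (∨⇓ (const⇓ _) d)))

allSuccsᵖ : PartRec 2
allSuccsᵖ = rec (proj 0F) (allSuccᵖ (proj 1F))

allSuccs⇓ : ∀ n A → allSuccsᵖ [ n ∷ code A ∷ [] ]⇓ code (allSuccs n A)
allSuccs⇓ zero    A = ⇓rec₀ ⇓proj
allSuccs⇓ (suc n) A = ⇓rec₊ (allSuccs⇓ n A) (allSucc⇓ ⇓proj)

failsAtNumeralᵖ : PartRec 2
failsAtNumeralᵖ =
  ¬ᵖ (const (code (¬ᶠ uniqueZero)) ∨ᵖ ∀ᵖ 0 (const (code (¬ᶠ Rᶠ 0 0)) ∨ᵖ allSuccsᵖ))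

failsAtNumeral⇓ : ∀ n A → failsAtNumeralᵖ [ n ∷ code A ∷ [] ]⇓ code (failsAtNumeral n A)
failsAtNumeral⇓ n A = ¬⇓ (∨⇓ (const⇓ _) (∀⇓ 0 (∨⇓ (const⇓ _) (allSuccs⇓ n A))))

diagᵖ : PartRec 1
diagᵖ = comp failsAtNumeralᵖ (proj 0F ∷ proj 0F ∷ [])

diag⇓ : ∀ A → diagᵖ [ code A ∷ [] ]⇓ code (failsAtNumeral (code A) A)
diag⇓ A = ⇓comp (⇓proj ∷ ⇓proj ∷ []) (failsAtNumeral⇓ (code A) A)

free-allSuccs : ∀ n {A} → (∀ {z} → FreeIn z A → z ≡ 0) → ∀ {z} → FreeIn z (allSuccs n A) → z ≡ 0
free-allSuccs zero    free p = free p
free-allSuccs (suc n) free (z≢1 , inj₁ p) = notSucc-free p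
  where
  notSucc-free : FreeIn _ notSucc → _ ≡ 0
  notSucc-free (inj₁ (inj₁ z≡0))        = z≡0
  notSucc-free (inj₁ (inj₂ z≡1))        = contradiction z≡1 z≢1
  notSucc-free (inj₂ (inj₁ (inj₁ z≡0))) = z≡0
  notSucc-free (inj₂ (inj₁ (inj₂ z≡1))) = contradiction z≡1 z≢1
  notSucc-free (inj₂ (inj₂ (inj₁ z≡1))) = contradiction z≡1 z≢1
  notSucc-free (inj₂ (inj₂ (inj₂ z≡1))) = contradiction z≡1 z≢1
free-allSuccs (suc n) free (z≢1 , inj₂ (z≢0 , inj₁ p)) = [ id , (λ z≡1 → contradiction z≡1 z≢1) ]′ p
free-allSuccs (suc n) free (z≢1 , inj₂ (z≢0 , inj₂ p)) = free-allSuccs n free p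

failsAtNumeral-closed : ∀ n {A} → (∀ {z} → FreeIn z A → z ≡ 0) → ∀ z → ¬ FreeIn z (failsAtNumeral n A)
failsAtNumeral-closed n free z (inj₁ (z≢0 , z≢1 , p)) =
  [ [ z≢0 , z≢0 ]′ , [ [ z≢1 , z≢1 ]′ , [ z≢0 , z≢1 ]′ ]′ ]′ p
failsAtNumeral-closed n free z (inj₂ (z≢0 , inj₁ p)) = [ z≢0 , z≢0 ]′ p
failsAtNumeral-closed n free z (inj₂ (z≢0 , inj₂ p)) = z≢0 (free-allSuccs n free p)

module _ (em : ExcludedMiddle 0ℓ) (F : Frame) where
  open Frame F

  ¬notSucc⇒Succ : ∀ {ρ} → ¬ Sat F ρ notSucc → Succ F (ρ 0) (ρ 1)
  ¬notSucc⇒Succ h =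
    decidable-stable em (h ∘ inj₁) , decidable-stable em (h ∘ inj₂ ∘ inj₁) , h ∘ inj₂ ∘ inj₂

  -- `k` counts the successors already passed. The claim about `A` is for all `ρ′`, since the chain
  -- is arbitrary and variable 1 is overwritten on the way.
  allSuccs-intro : ∀ n {A ρ k} → Num F k (ρ 0) →
                   (∀ ρ′ → Num F (n + k) (ρ′ 0) → Sat F ρ′ A) → Sat F ρ (allSuccs n A)
  allSuccs-intro zero    k-num h = h _ k-num
  allSuccs-intro (suc n) {A} {ρ} {k} k-num h w with em {Sat F (ρ [ 1 ↦ w ]) notSucc}
  ... | yes p = inj₁ p
  ... | no ¬p = inj₂ next-sat
    where
    next-sat : ∀ u → Sat F ((ρ [ 1 ↦ w ]) [ 0 ↦ u ]) ((¬ᶠ (0 ≈ᶠ 1)) ∨ᶠ allSuccs n A)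
    next-sat u with em {u ≡ w}
    ... | no u≢w   = inj₁ u≢w
    ... | yes refl = inj₂ (allSuccs-intro n {k = suc k} (ρ 0 , k-num , ¬notSucc⇒Succ {ρ [ 1 ↦ w ]} ¬p)
      λ ρ′ → h ρ′ ∘ subst (λ j → Num F j (ρ′ 0)) (+-suc n k))

  -- A zero of the double has a twin zero in the other copy, against `uniqueZero`; without any zero
  -- the second conjunct fails, as it demands one.
  failsAtNumeral-¬double : ∀ n A → ¬ (∀ ρ → Sat (double F) ρ (failsAtNumeral n A))
  failsAtNumeral-¬double n A h = h ρ (inj₂ λ w → two-zeros w em)
    where
    ρ : ℕ → W × Bool
    ρ _ = point , false
    two-zeros : ∀ w → Dec (Frame.R (double F) w w) → _
    two-zeros w       (no ¬r)        = inj₁ ¬r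
    two-zeros (w , _) (yes (r , _)) = ⊥-elim (h ρ (inj₁ λ unique →
      [ (λ ¬r → ¬r (r , refl)) , [ (λ ¬r → ¬r (r , refl)) , (λ ()) ]′ ]′
        (unique (w , true) (w , false))))

-- Each layer is instantiated at the genuine successor `num (suc k)`.
allSuccs-elim : ∀ n {A ρ k} → ρ 0 ≡ num k → Sat standard ρ (allSuccs n A) →
                ∃[ ρ′ ] ρ′ 0 ≡ num (n + k) × Sat standard ρ′ A
allSuccs-elim zero    ρ0≡ h = _ , ρ0≡ , h
allSuccs-elim (suc n) {k = k} ρ0≡ h with k≼ , k⟶ , ¬zero ← suc-Succ k | h (num (suc k))
... | inj₁ (inj₁ ¬≼)        rewrite ρ0≡ = contradiction k≼ ¬≼
... | inj₁ (inj₂ (inj₁ ¬⟶)) rewrite ρ0≡ = contradiction k⟶ ¬⟶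
... | inj₁ (inj₂ (inj₂ z))  = contradiction z ¬zero
... | inj₂ h′ with h′ (num (suc k))
...   | inj₁ ≢ = contradiction refl ≢
...   | inj₂ p with ρ′ , ρ′0≡ , q ← allSuccs-elim n refl p =
  ρ′ , trans ρ′0≡ (cong num (+-suc n k)) , q

-- The diagonal sentence and the two verdicts on it

-- Phrased as the absence of a nonzero value, so that soundness alone proves it in every frame when
-- the value is 0.
vanishesFm : PartRec 1 → Fm 1
vanishesFm f = not (ex (and (graph f (λ _ → 1F) 0F) (not (isZero 0F))))

vanishes : PartRec 1 → FOFormula
vanishes f = named (0 ∷ []) 1 (vanishesFm f)

vanishes-free : ∀ f {z} → FreeIn z (vanishes f) → z ≡ 0
vanishes-free f p with zero , z≡0 ← free-named (0 ∷ []) 1 (vanishesFm f) p = z≡0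

diagonalVanishes : PartRec 1 → FOFormula
diagonalVanishes f = vanishes (comp f (diagᵖ ∷ []))

-- `A` says that `f` after `diagᵖ` vanishes at variable 0. Since `diagᵖ` maps the code of `A` to the
-- code of this sentence, the sentence speaks of the value of `f` at its own code.
diagonal : PartRec 1 → Sentence
diagonal f = failsAtNumeral (code A) A ,
             failsAtNumeral-closed (code A) (vanishes-free (comp f (diagᵖ ∷ [])))
  where
  A : FOFormula
  A = diagonalVanishes f

diagonal-value : ∀ f {y} → f [ ⌜ proj₁ (diagonal f) ⌝ ∷ [] ]⇓ y →
                 comp f (diagᵖ ∷ []) [ code (diagonalVanishes f) ∷ [] ]⇓ y
diagonal-value f {y} d = ⇓comp (diag⇓ (diagonalVanishes f) ∷ [])
  (subst (λ c → f [ c ∷ [] ]⇓ y) (sym (code≡ (proj₁ (diagonal f)))) d)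

module _ (em : ExcludedMiddle 0ℓ) where

  env₀ : ∀ {F} (ρ : ℕ → Frame.W F) → Env em F (0 ∷ []) 1 ρ (ρ 0 ∷ [])
  env₀ ρ = record { fresh = λ { zero → s≤s z≤n } ; agree = λ { zero → refl } }

  value-0⇒unsatisfiable : ∀ {f n} → f [ n ∷ [] ]⇓ 0 → ∀ F ρ → ¬ Sat F ρ (failsAtNumeral n (vanishes f))
  value-0⇒unsatisfiable {f} {n} d F ρ h = h (inj₂ λ w → sat w em)
    where
    sat : ∀ w → Dec (Frame.R F w w) → _
    sat w (no ¬r) = inj₁ ¬r
    sat w (yes r) = inj₂ (allSuccs-intro em F n {k = 0} r λ ρ′ n-num →
      from (sat-named em F (env₀ ρ′) (vanishesFm f)) λ (v , fv , ¬zero) →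
        ¬zero (graph-sound F d _ 0F (v ∷ ρ′ 0 ∷ [])
          (λ { zero → subst (λ j → Num F j (ρ′ 0)) (+-identityʳ n) n-num }) fv))

  -- Completeness provides `num 1`, which is not reflexive, as a value at `num n`; `loop` is the
  -- only reflexive edge, so zero is unique.
  value-1⇒standard-model : ∀ {f n} → f [ n ∷ [] ]⇓ 1 →
                           ∀ ρ → Sat standard ρ (failsAtNumeral n (vanishes f))
  value-1⇒standard-model {f} {n} d ρ (inj₁ ¬unique) = ¬unique λ w w′ → unique w w′ em em
    where
    unique : ∀ w w′ → Dec (w ⟶ w) → Dec (w′ ⟶ w′) → ¬ (w ⟶ w) ⊎ ¬ (w′ ⟶ w′) ⊎ w ≡ w′
    unique _ _ (no ¬r)    _          = inj₁ ¬r
    unique _ _ (yes _)    (no ¬r)    = inj₂ (inj₁ ¬r)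
    unique _ _ (yes loop) (yes loop) = inj₂ (inj₂ refl)
  value-1⇒standard-model {f} {n} d ρ (inj₂ h) with h (num 0)
  ... | inj₁ ¬loop = ¬loop loop
  ... | inj₂ p with ρ′ , ρ′0≡ , q ← allSuccs-elim n refl p =
    to (sat-named em standard (env₀ ρ′) (vanishesFm f)) q
      (num 1 , graph-complete f d _ 0F (num 1 ∷ ρ′ 0 ∷ [])
        (λ { zero → trans ρ′0≡ (cong num (+-identityʳ n)) }) refl , λ ())

  value-0⇒Unsatisfiable : ∀ f → f [ ⌜ proj₁ (diagonal f) ⌝ ∷ [] ]⇓ 0 → Unsatisfiable (diagonal f)
  value-0⇒Unsatisfiable f d F h =
    value-0⇒unsatisfiable (diagonal-value f d) F (λ _ → Frame.point F) (h _)

  value-1⇒¬MD : ∀ f → f [ ⌜ proj₁ (diagonal f) ⌝ ∷ [] ]⇓ 1 → ¬ MD (diagonal f)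
  value-1⇒¬MD f d md = failsAtNumeral-¬double em standard (code (diagonalVanishes f)) (diagonalVanishes f)
    (MD⇒closed-under-double (diagonal f) md standard
      (value-1⇒standard-model (diagonal-value f d)))

-- Undecidability of all three problems

module _ (em : ∀ {ℓ} → ExcludedMiddle ℓ) {ℓ} (P : Pred Sentence ℓ)
         (unsat⇒P : ∀ C → Unsatisfiable C → P C) (P⇒MD : ∀ C → P C → MD C) where

  -- If `P C` holds, `f` accepts and `C` is not even modally definable; otherwise `f` rejects and
  -- `C`, being unsatisfiable, has `P` after all.
  misjudged⇒¬Decides : ∀ f C →
    (f [ ⌜ proj₁ C ⌝ ∷ [] ]⇓ 0 → Unsatisfiable C) →
    (f [ ⌜ proj₁ C ⌝ ∷ [] ]⇓ 1 → ¬ MD C) →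
    ¬ Decides f P
  misjudged⇒¬Decides f C rejected accepted decides with em {P = P C}
  ... | yes p = accepted (proj₁ (decides C) p) (P⇒MD C p)
  ... | no ¬p = ¬p (unsat⇒P C (rejected (proj₂ (decides C) ¬p)))

  undecidable : Undecidable P
  undecidable (f , decides) = misjudged⇒¬Decides f (diagonal f)
    (value-0⇒Unsatisfiable em f) (value-1⇒¬MD em f) decides

proposition33 : (∀ {ℓ} → ExcludedMiddle ℓ) → Undecidable MD × Undecidable PD × Undecidable ND
proposition33 em =
    undecidable em MD Unsatisfiable⇒MD (λ _ → id)
  , undecidable em PD Unsatisfiable⇒PD PD⇒MD
  , undecidable em ND Unsatisfiable⇒ND ND⇒MD
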